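{- If $C$ and $C'$ are two cycle graphs with the same degree sequence, then there exists a u-switch sequence transforming $C$ into $C'$: 2-switches $\tau_1,\dots,\tau_k$ ($k\ge0$) such that, with $C_0=C$ and $C_i=\tau_i(C_{i-1})$, each $\tau_i$ is a u-switch over $C_{i-1}$ and $C_k=C'$.
   Context: Graphs are finite, simple, undirected, labeled with vertex set $[n]$; the degree sequence of $G$ is $(d_1,\dots,d_n)$ with $d_i$ the degree of vertex $i$ (so two graphs have the same degree sequence iff each vertex has the same degree in both). A unicyclic graph is a connected graph with exactly one cycle. For vertices $a,b,c,d$, $A=\binom{a\ b}{c\ d}$ is interchangeable in $G$ if $ab,cd\in E(G)$, $\{a,b\}\cap\{c,d\}=\varnothing$, $ac,bd\notin E(G)$; the 2-switch $\tau_A$ sends $G$ to $G-ab-cd+ac+bd$ if $A$ is interchangeable and to $G$ otherwise (trivial). A nontrivial 2-switch $\tau$ over a unicyclic $U$ is a u-switch if $\tau(U)$ is unicyclic. -}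

module Defs where

open import Data.Fin using (Fin; toℕ; _≟_)
open import Data.Fin.Permutation using (Permutation′; _⟨$⟩ʳ_)
open import Data.List using (List; []; _∷_)
open import Data.Nat using (ℕ; suc; _≤_)
open import Data.Product using (Σ; ∃; _×_; _,_; swap)
open import Data.Sum using (_⊎_; inj₁; inj₂)
open import Data.Vec using (Vec; allFin; count; tabulate)
open import Function using (Injective; _⇔_)
open import Level using (0ℓ)
open import Relation.Binary using (Rel; Decidable; Symmetric; Irreflexive)
open import Relation.Binary.Construct.Closure.ReflexiveTransitive using (Star)
open import Relation.Binary.PropositionalEquality using (_≡_; _≢_; refl; sym; trans)
open import Relation.Nullary using (¬_; Dec; yes; no; ¬?; _×-dec_; _⊎-dec_)

record Graph (n : ℕ) : Set₁ where
  field
    Adj        : Rel (Fin n) 0ℓ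
    adj?       : Decidable Adj
    adj-sym    : Symmetric Adj
    adj-irrefl : Irreflexive _≡_ Adj

open Graph public

private
  variable
    n k : ℕ

-- Equality of labeled graphs: the same edges on the same labels
-- (not isomorphism).
infix 4 _≈ᴳ_
_≈ᴳ_ : Graph n → Graph n → Set
G ≈ᴳ H = ∀ x y → Adj G x y ⇔ Adj H x y

degree : Graph n → Fin n → ℕ
degree G x = count (adj? G x) (allFin _)

degreeSequence : Graph n → Vec ℕ n
degreeSequence G = tabulate (degree G)

-- j is the successor of i in the cyclic order 0, 1, …, k-1, 0.
CyclicSuc : Fin k → Fin k → Set
CyclicSuc {k} i j = toℕ j ≡ suc (toℕ i) ⊎ (suc (toℕ i) ≡ k × toℕ j ≡ 0)

-- The vertices can be listed as v₀, …, vₙ₋₁ (n ≥ 3) so that the edges are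
-- exactly the pairs of cyclically consecutive vertices.
IsCycleGraph : Graph n → Set
IsCycleGraph {n} G =
  3 ≤ n ×
  Σ (Permutation′ n) λ v →
    ∀ i j → Adj G (v ⟨$⟩ʳ i) (v ⟨$⟩ʳ j) ⇔ (CyclicSuc i j ⊎ CyclicSuc j i)

record Cycle (G : Graph n) : Set where
  field
    len       : ℕ
    3≤len     : 3 ≤ len
    vertex    : Fin len → Fin n
    injective : Injective _≡_ _≡_ vertex
    adjacent  : ∀ i j → CyclicSuc i j → Adj G (vertex i) (vertex j)

-- The equation {x, y} = {a, b} between unordered pairs.
SamePair : (a b x y : Fin n) → Set
SamePair a b x y = (x ≡ a × y ≡ b) ⊎ (x ≡ b × y ≡ a)

samePair? : (a b x y : Fin n) → Dec (SamePair a b x y)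
samePair? a b x y = (x ≟ a ×-dec y ≟ b) ⊎-dec (x ≟ b ×-dec y ≟ a)

CycleEdge : {G : Graph n} → Cycle G → Fin n → Fin n → Set
CycleEdge C x y = ∃ λ i → ∃ λ j → CyclicSuc i j × SamePair (vertex i) (vertex j) x y
  where open Cycle C

-- A cycle is counted as a subgraph: the starting point and the direction in
-- which it is listed do not matter, only its edge set does.
infix 4 _≈ᶜ_
_≈ᶜ_ : {G : Graph n} → Cycle G → Cycle G → Set
C ≈ᶜ D = ∀ x y → CycleEdge C x y ⇔ CycleEdge D x y

Connected : Graph n → Set
Connected G = ∀ x y → Star (Adj G) x y

Unicyclic : Graph n → Set
Unicyclic G = Connected G × Σ (Cycle G) λ C → ∀ (D : Cycle G) → D ≈ᶜ C

-- The matrix with first row a b and second row c d.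
record Matrix (n : ℕ) : Set where
  constructor ⟦_,_⨾_,_⟧
  field
    a b c d : Fin n

Interchangeable : Matrix n → Graph n → Set
Interchangeable ⟦ a , b ⨾ c , d ⟧ G =
  (Adj G a b × Adj G c d) ×
  (a ≢ c × a ≢ d × b ≢ c × b ≢ d) ×
  (¬ Adj G a c × ¬ Adj G b d)

interchangeable? : (A : Matrix n) (G : Graph n) → Dec (Interchangeable A G)
interchangeable? ⟦ a , b ⨾ c , d ⟧ G =
  (adj? G a b ×-dec adj? G c d) ×-dec
  (¬? (a ≟ c) ×-dec ¬? (a ≟ d) ×-dec ¬? (b ≟ c) ×-dec ¬? (b ≟ d)) ×-dec
  (¬? (adj? G a c) ×-dec ¬? (adj? G b d))

samePair-sym : (a b x y : Fin n) → SamePair a b x y → SamePair a b y x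
samePair-sym a b x y (inj₁ p) = inj₂ (swap p)
samePair-sym a b x y (inj₂ p) = inj₁ (swap p)

samePair-irrefl : (a b x : Fin n) → a ≢ b → ¬ SamePair a b x x
samePair-irrefl a b x a≢b (inj₁ (x≡a , x≡b)) = a≢b (trans (sym x≡a) x≡b)
samePair-irrefl a b x a≢b (inj₂ (x≡b , x≡a)) = a≢b (trans (sym x≡a) x≡b)

-- G - ab - cd + ac + bd; interchangeability is used only to see that ac and
-- bd are not loops.
exchange : (A : Matrix n) (G : Graph n) → Interchangeable A G → Graph n
exchange ⟦ a , b ⨾ c , d ⟧ G (_ , (a≢c , _ , _ , b≢d) , _) = record
  { Adj = λ x y →
      (Adj G x y × ¬ SamePair a b x y × ¬ SamePair c d x y)
      ⊎ SamePair a c x y ⊎ SamePair b d x y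
  ; adj? = λ x y →
      (adj? G x y ×-dec ¬? (samePair? a b x y) ×-dec ¬? (samePair? c d x y))
      ⊎-dec (samePair? a c x y ⊎-dec samePair? b d x y)
  ; adj-sym = λ {x} {y} → λ
      { (inj₁ (e , p , q)) →
          inj₁ ( adj-sym G e
               , (λ r → p (samePair-sym a b y x r))
               , (λ r → q (samePair-sym c d y x r)))
      ; (inj₂ (inj₁ r)) → inj₂ (inj₁ (samePair-sym a c x y r))
      ; (inj₂ (inj₂ r)) → inj₂ (inj₂ (samePair-sym b d x y r))
      }
  ; adj-irrefl = λ {x} → λ
      { refl (inj₁ (e , _)) → adj-irrefl G refl e
      ; refl (inj₂ (inj₁ r)) → samePair-irrefl a c x a≢c r
      ; refl (inj₂ (inj₂ r)) → samePair-irrefl b d x b≢d r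
      }
  }

τ : Matrix n → Graph n → Graph n
τ A G with interchangeable? A G
... | yes p = exchange A G p
... | no  _ = G

-- τ A acts nontrivially on U exactly when A is interchangeable in U.
IsUSwitch : Matrix n → Graph n → Set
IsUSwitch A U = Unicyclic U × Interchangeable A U × Unicyclic (τ A U)

-- The switches τ A₁, …, τ Aₖ, applied in the order of the list, transform G
-- into H, each being a u-switch over the graph it is applied to.
USwitchSequence : List (Matrix n) → Graph n → Graph n → Set
USwitchSequence []       G H = G ≈ᴳ H
USwitchSequence (A ∷ As) G H = IsUSwitch A G × USwitchSequence As (τ A G) H

{-# OPTIONS --safe #-}

-- For consecutive vertices a, b, c, d of a cycle graph on at least four
-- vertices, the 2-switch G - ab - cd + ac + bd interchanges the labels b and c
-- in the cyclic order, so its result is again a cycle graph.  The adjacent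
-- transpositions generate the symmetric group, hence such switches lead from
-- any cyclic order to any other.  On three vertices there is only one cycle
-- graph.
module Submission where

open import Defs
open import Data.Empty using (⊥)
open import Data.Fin using (Fin; zero; suc; toℕ; fromℕ; fromℕ<; inject₁; _≟_)
open import Data.Fin.Induction using (<-weakInduction)
open import Data.Fin.Patterns using (0F; 1F; 2F)
open import Data.Fin.Permutation
  using (Permutation′; _⟨$⟩ʳ_; _⟨$⟩ˡ_; _∘ₚ_; _≈_; flip; inverseˡ; inverseʳ; transpose)
open import Data.Fin.Permutation.Components using (transpose-inverse)
open import Data.Fin.Permutation.Transposition.List
  using (TranspositionList; eval; decompose; eval-decompose)
open import Data.Fin.Properties
  using (toℕ-injective; toℕ-fromℕ; toℕ-fromℕ<; toℕ-inject₁; toℕ<n)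
open import Data.List using ([]; _∷_)
open import Data.Nat using (ℕ; zero; suc; _+_; _≤_; _<_; s≤s; z≤n; _<?_)
open import Data.Nat.Properties
  using (suc-injective; m≢1+n+m; +-comm; +-suc; m≤m+n; m≤n+m; ≤-trans; ≤-antisym;
         ≮⇒≥; <-cmp; m≤n⇒∃[o]m+o≡n; 1+n≢n)
open import Data.Product using (∃; _×_; _,_; proj₁; proj₂)
open import Data.Sum using (_⊎_; inj₁; inj₂)
open import Function using (_⇔_; mk⇔; Equivalence; _∘_)
open import Function.Construct.Composition using (_⇔-∘_)
open import Function.Construct.Symmetry using (⇔-sym)
open import Relation.Binary using (tri<; tri≈; tri>)
open import Relation.Binary.Construct.Closure.ReflexiveTransitive
  using (Star; ε; _◅_; _◅◅_; reverse)
open import Relation.Binary.PropositionalEquality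
  using (_≡_; _≢_; ≢-sym; refl; sym; trans; cong; subst; subst₂; module ≡-Reasoning)
open import Relation.Nullary using (¬_; Dec; yes; no; contradiction)
open import Relation.Nullary.Decidable using (dec-true; dec-false)

open Equivalence using (to; from)

private
  variable
    n k : ℕ

-- The cyclic order

-- `CyclicSuc` with numbers in place of `toℕ i` and `toℕ j`: variables let the equations be matched
-- by `refl`.
CycSucℕ : ℕ → ℕ → ℕ → Set
CycSucℕ k a b = b ≡ suc a ⊎ (suc a ≡ k × b ≡ 0)

-- A closed walk of successor steps must wrap around, since otherwise the numbers keep growing. A
-- single wrap makes `k` the length of the walk, here 2. Two wraps would force `k` to be 1; that
-- case is left to the coverage check. The same count settles `¬3-cyclic`.
¬2-cyclic : ∀ {a b} → 3 ≤ k → CycSucℕ k a b → CycSucℕ k b a → ⊥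
¬2-cyclic {a = a} _ (inj₁ refl) (inj₁ e) = m≢1+n+m a {1} e
¬2-cyclic (s≤s (s≤s ())) (inj₁ refl) (inj₂ (refl , refl))
¬2-cyclic (s≤s (s≤s ())) (inj₂ (refl , refl)) (inj₁ refl)

¬3-cyclic : ∀ {a b c} → 4 ≤ k → CycSucℕ k a b → CycSucℕ k b c → CycSucℕ k c a → ⊥
¬3-cyclic {a = a} _ (inj₁ refl) (inj₁ refl) (inj₁ e) = m≢1+n+m a {2} e
¬3-cyclic (s≤s (s≤s (s≤s ()))) (inj₁ refl) (inj₁ refl) (inj₂ (refl , refl))
¬3-cyclic (s≤s (s≤s (s≤s ()))) (inj₁ refl) (inj₂ (refl , refl)) (inj₁ refl)
¬3-cyclic (s≤s (s≤s (s≤s ()))) (inj₂ (refl , refl)) (inj₁ refl) (inj₁ refl)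

cycSuc-functional : {i j j′ : Fin k} → CyclicSuc i j → CyclicSuc i j′ → j ≡ j′
cycSuc-functional (inj₁ p) (inj₁ q) = toℕ-injective (trans p (sym q))
cycSuc-functional {j = j} (inj₁ p) (inj₂ (q , _)) =
  contradiction (trans p q) (toℕ≢k j)
  where
  toℕ≢k : (j : Fin k) → toℕ j ≢ k
  toℕ≢k (suc j) e = toℕ≢k j (suc-injective e)
cycSuc-functional p@(inj₂ _) q@(inj₁ _) = sym (cycSuc-functional q p)
cycSuc-functional (inj₂ (_ , p)) (inj₂ (_ , q)) = toℕ-injective (trans p (sym q))

cycSuc-injective : {i i′ j : Fin k} → CyclicSuc i j → CyclicSuc i′ j → i ≡ i′
cycSuc-injective (inj₁ p) (inj₁ q) = toℕ-injective (suc-injective (trans (sym p) q))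
cycSuc-injective (inj₁ p) (inj₂ (_ , q)) with () ← trans (sym p) q
cycSuc-injective (inj₂ (_ , p)) (inj₁ q) with () ← trans (sym p) q
cycSuc-injective (inj₂ (p , _)) (inj₂ (q , _)) =
  toℕ-injective (suc-injective (trans p (sym q)))

successor : (i : Fin k) → ∃ λ j → CyclicSuc i j
successor {suc m} i with suc (toℕ i) <? suc m
... | yes i+1<k = fromℕ< i+1<k , inj₁ (toℕ-fromℕ< i+1<k)
... | no  i+1≮k = zero , inj₂ (≤-antisym (toℕ<n i) (≮⇒≥ i+1≮k) , refl)

predecessor : (i : Fin k) → ∃ λ j → CyclicSuc j i
predecessor {suc m} zero    = fromℕ m , inj₂ (cong suc (toℕ-fromℕ m) , refl)
predecessor         (suc i) = inject₁ i , inj₁ (cong suc (sym (toℕ-inject₁ i)))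

Consecutive : Fin k → Fin k → Set
Consecutive i j = CyclicSuc i j ⊎ CyclicSuc j i

-- Successors and predecessors are unique, so distinct `p` and `q` lie on opposite sides of `i`, and
-- `j` shares its side with one of them.
consecutive-atMostTwo : {i j p q : Fin k} → Consecutive i j → Consecutive i p → Consecutive i q →
  p ≢ q → j ≡ p ⊎ j ≡ q
consecutive-atMostTwo (inj₁ j) (inj₁ p) _        _   = inj₁ (cycSuc-functional j p)
consecutive-atMostTwo (inj₂ j) (inj₂ p) _        _   = inj₁ (cycSuc-injective j p)
consecutive-atMostTwo (inj₁ j) (inj₂ p) (inj₁ q) _   = inj₂ (cycSuc-functional j q)
consecutive-atMostTwo (inj₁ j) (inj₂ p) (inj₂ q) p≢q = contradiction (cycSuc-injective p q) p≢q
consecutive-atMostTwo (inj₂ j) (inj₁ p) (inj₂ q) _   = inj₂ (cycSuc-injective j q)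
consecutive-atMostTwo (inj₂ j) (inj₁ p) (inj₁ q) p≢q = contradiction (cycSuc-functional p q) p≢q

-- Cycle graphs are unicyclic

-- The adjacency condition of `IsCycleGraph` for a fixed listing `v`. As a record type it lets
-- unification recover `v` and `G`.
record CycleVia (v : Permutation′ n) (G : Graph n) : Set where
  constructor cycleVia
  field
    adjacency : ∀ i j → Adj G (v ⟨$⟩ʳ i) (v ⟨$⟩ʳ j) ⇔ Consecutive i j

open CycleVia

to-injective : (v : Permutation′ n) {i j : Fin n} → v ⟨$⟩ʳ i ≡ v ⟨$⟩ʳ j → i ≡ j
to-injective v e = trans (sym (inverseˡ v)) (trans (cong (v ⟨$⟩ˡ_) e) (inverseˡ v))

cycleVia-resp-≈ : {v w : Permutation′ n} {G : Graph n} → v ≈ w → CycleVia v G → CycleVia w G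
cycleVia-resp-≈ {G = G} v≈w via = cycleVia λ i j →
  subst₂ (λ x y → Adj G x y ⇔ Consecutive i j) (v≈w i) (v≈w j) (adjacency via i j)

-- Maximum degree two without counting: two distinct known neighbours exhaust the neighbourhood.
AtMostTwoNeighbours : Graph n → Set
AtMostTwoNeighbours G = ∀ {x y p q} → Adj G x y → Adj G x p → Adj G x q → p ≢ q → y ≡ p ⊎ y ≡ q

module _ {v : Permutation′ n} {G : Graph n} (via : CycleVia v G) where

  adj⇔consecutive : ∀ x y → Adj G x y ⇔ Consecutive (v ⟨$⟩ˡ x) (v ⟨$⟩ˡ y)
  adj⇔consecutive x y = subst₂ (λ x′ y′ → Adj G x′ y′ ⇔ Consecutive (v ⟨$⟩ˡ x) (v ⟨$⟩ˡ y))
    (inverseʳ v) (inverseʳ v) (adjacency via (v ⟨$⟩ˡ x) (v ⟨$⟩ˡ y))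

  atMostTwoNeighbours : AtMostTwoNeighbours G
  atMostTwoNeighbours {x} {y} {p} {q} xy xp xq p≢q
    with consecutive-atMostTwo (to (adj⇔consecutive x y) xy) (to (adj⇔consecutive x p) xp)
           (to (adj⇔consecutive x q) xq) (p≢q ∘ to-injective (flip v))
  ... | inj₁ e = inj₁ (to-injective (flip v) e)
  ... | inj₂ e = inj₂ (to-injective (flip v) e)

cycleVia-unique : {v : Permutation′ n} {G H : Graph n} → CycleVia v G → CycleVia v H → G ≈ᴳ H
cycleVia-unique viaG viaH x y = ⇔-sym (adj⇔consecutive viaH x y) ⇔-∘ adj⇔consecutive viaG x y

cycleVia-connected : {v : Permutation′ n} {G : Graph n} → CycleVia v G → Connected G
cycleVia-connected {zero}  via ()
cycleVia-connected {suc m} {v} {G} via x y = reverse (adj-sym G) (fromOrigin x) ◅◅ fromOrigin y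
  where
  fromOrigin′ : ∀ i → Star (Adj G) (v ⟨$⟩ʳ zero) (v ⟨$⟩ʳ i)
  fromOrigin′ = <-weakInduction _ ε λ i path →
    path ◅◅ from (adjacency via (inject₁ i) (suc i)) (inj₁ (proj₂ (predecessor (suc i)))) ◅ ε

  fromOrigin : ∀ x → Star (Adj G) (v ⟨$⟩ʳ zero) x
  fromOrigin x = subst (Star (Adj G) _) (inverseʳ v) (fromOrigin′ (v ⟨$⟩ˡ x))

module _ {G : Graph n} (D : Cycle G) where
  open Cycle D

  cycleEdge⇒adj : ∀ {x y} → CycleEdge D x y → Adj G x y
  cycleEdge⇒adj (i , j , s , inj₁ (refl , refl)) = adjacent i j s
  cycleEdge⇒adj (i , j , s , inj₂ (refl , refl)) = adj-sym G (adjacent i j s)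

  module _ (two : AtMostTwoNeighbours G) where

    -- The two neighbours of vertex i along D already exhaust its neighbours in G.
    adj⇒cycleEdge-at : ∀ i {y} → Adj G (vertex i) y → CycleEdge D (vertex i) y
    adj⇒cycleEdge-at i iy with predecessor i | successor i
    ... | p , p→i | q , i→q
      with two iy (adj-sym G (adjacent p i p→i)) (adjacent i q i→q) (p≢q ∘ injective)
      where
      p≢q : p ≢ q
      p≢q refl = ¬2-cyclic 3≤len p→i i→q
    ... | inj₁ refl = p , i , p→i , inj₂ (refl , refl)
    ... | inj₂ refl = i , q , i→q , inj₁ (refl , refl)

    -- Every edge of `G` at a vertex of `D` is an edge of `D`, so a path starting on `D` never
    -- leaves it.
    onCycle-closed : ∀ {x y} → Star (Adj G) x y → (∃ λ i → vertex i ≡ x) → ∃ λ i → vertex i ≡ y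
    onCycle-closed ε on = on
    onCycle-closed (xz ◅ path) (i , refl) with adj⇒cycleEdge-at i xz
    ... | _ , j , _ , inj₁ (_ , refl) = onCycle-closed path (j , refl)
    ... | j , _ , _ , inj₂ (_ , refl) = onCycle-closed path (j , refl)

    -- Connectedness puts every vertex on `D`, and there the edges of `G` are edges of `D`. Hence
    -- all cycles of `G` have the same edge set, which gives uniqueness in `cycleVia-unicyclic`.
    cycleEdge⇔adj : Connected G → ∀ x y → CycleEdge D x y ⇔ Adj G x y
    cycleEdge⇔adj connected x y = mk⇔ cycleEdge⇒adj adj⇒cycleEdge
      where
      origin : Fin len
      origin = fromℕ< (≤-trans (s≤s z≤n) 3≤len)

      adj⇒cycleEdge : Adj G x y → CycleEdge D x y
      adj⇒cycleEdge xy with onCycle-closed (connected (vertex origin) x) (origin , refl)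
      ... | i , refl = adj⇒cycleEdge-at i xy

cycleVia-unicyclic : {v : Permutation′ n} {G : Graph n} → 3 ≤ n → CycleVia v G → Unicyclic G
cycleVia-unicyclic {n} {v} {G} 3≤n via =
  connected , hamiltonian , λ D x y → ⇔-sym (edges hamiltonian x y) ⇔-∘ edges D x y
  where
  connected : Connected G
  connected = cycleVia-connected via

  edges : (D : Cycle G) → ∀ x y → CycleEdge D x y ⇔ Adj G x y
  edges D = cycleEdge⇔adj D (atMostTwoNeighbours via) connected

  hamiltonian : Cycle G
  hamiltonian = record
    { len       = n
    ; 3≤len     = 3≤n
    ; vertex    = v ⟨$⟩ʳ_
    ; injective = to-injective v
    ; adjacent  = λ i j s → from (adjacency via i j) (inj₁ s)
    }

-- Transpositions

transpose-left : (i j : Fin n) → transpose i j ⟨$⟩ʳ i ≡ j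
transpose-left i j rewrite dec-true (i ≟ i) refl = refl

transpose-right : (i j : Fin n) → transpose i j ⟨$⟩ʳ j ≡ i
transpose-right i j with j ≟ i
... | yes j≡i = j≡i
... | no  _ rewrite dec-true (j ≟ j) refl = refl

transpose-other : {i j k : Fin n} → k ≢ i → k ≢ j → transpose i j ⟨$⟩ʳ k ≡ k
transpose-other {i = i} {j} {k} k≢i k≢j
  rewrite dec-false (k ≟ i) k≢i | dec-false (k ≟ j) k≢j = refl

transpose-unique : {i j : Fin n} (f : Fin n → Fin n) → f i ≡ j → f j ≡ i →
  (∀ k → k ≢ i → k ≢ j → f k ≡ k) → ∀ k → transpose i j ⟨$⟩ʳ k ≡ f k
transpose-unique {i = i} {j} f fi fj fk k with k ≟ i
... | yes refl = sym fi
... | no k≢i with k ≟ j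
...   | yes refl = sym fj
...   | no k≢j   = sym (fk k k≢i k≢j)

transpose-comm : (i j : Fin n) → transpose i j ≈ transpose j i
transpose-comm i j = transpose-unique (transpose j i ⟨$⟩ʳ_) (transpose-right j i) (transpose-left j i)
  λ k k≢i k≢j → transpose-other k≢j k≢i

transpose-involutive : (i j k : Fin n) → transpose i j ⟨$⟩ʳ (transpose i j ⟨$⟩ʳ k) ≡ k
transpose-involutive i j k =
  -- `transpose-inverse` cancels `transpose i j` against `transpose j i`, so the inner one is
  -- flipped first.
  trans (cong (transpose i j ⟨$⟩ʳ_) (transpose-comm i j k)) (transpose-inverse i j)

transpose-refl : (i k : Fin n) → transpose i i ⟨$⟩ʳ k ≡ k
transpose-refl i = transpose-unique (λ k → k) refl refl λ _ _ _ → refl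

-- Conjugating the swap of `s` and `j` by the swap of `i` and `s` renames `s` to `i`. This splits a
-- distant swap into shorter ones.
transpose-conj : {i s j : Fin n} → i ≢ s → s ≢ j → i ≢ j →
  transpose i j ≈ transpose i s ∘ₚ transpose s j ∘ₚ transpose i s
transpose-conj {i = i} {s} {j} i≢s s≢j i≢j = transpose-unique (λ k → is (sj (is k)))
  (begin
    is (sj (is i)) ≡⟨ cong (is ∘ sj) (transpose-left i s) ⟩
    is (sj s)      ≡⟨ cong is (transpose-left s j) ⟩
    is j           ≡⟨ transpose-other (≢-sym i≢j) (≢-sym s≢j) ⟩
    j              ∎)
  (begin
    is (sj (is j)) ≡⟨ cong (is ∘ sj) (transpose-other (≢-sym i≢j) (≢-sym s≢j)) ⟩
    is (sj j)      ≡⟨ cong is (transpose-right s j) ⟩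
    is s           ≡⟨ transpose-right i s ⟩
    i              ∎)
  other
  where
  open ≡-Reasoning
  is sj : Fin _ → Fin _
  is = transpose i s ⟨$⟩ʳ_
  sj = transpose s j ⟨$⟩ʳ_

  other : ∀ k → k ≢ i → k ≢ j → is (sj (is k)) ≡ k
  other k k≢i k≢j with k ≟ s
  ... | yes refl = begin
    is (sj (is s)) ≡⟨ cong (is ∘ sj) (transpose-right i s) ⟩
    is (sj i)      ≡⟨ cong is (transpose-other i≢s i≢j) ⟩
    is i           ≡⟨ transpose-left i s ⟩
    s              ∎
  ... | no k≢s = begin
    is (sj (is k)) ≡⟨ cong (is ∘ sj) (transpose-other k≢i k≢s) ⟩
    is (sj k)      ≡⟨ cong is (transpose-other k≢s k≢j) ⟩
    is k           ≡⟨ transpose-other k≢i k≢s ⟩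
    k              ∎

-- Turns a swap of positions in the listing `v` into a swap of vertex labels.
transpose-natural : (v : Permutation′ n) (i j k : Fin n) →
  v ⟨$⟩ʳ (transpose i j ⟨$⟩ʳ k) ≡ transpose (v ⟨$⟩ʳ i) (v ⟨$⟩ʳ j) ⟨$⟩ʳ (v ⟨$⟩ʳ k)
transpose-natural v i j k with k ≟ i
... | yes refl = sym (transpose-left (v ⟨$⟩ʳ i) (v ⟨$⟩ʳ j))
... | no k≢i with k ≟ j
...   | yes refl = sym (transpose-right (v ⟨$⟩ʳ i) (v ⟨$⟩ʳ j))
...   | no k≢j   = sym (transpose-other (k≢i ∘ to-injective v) (k≢j ∘ to-injective v))

-- Generation of the symmetric group by adjacent transpositions

module _ {ℓ} (P : Permutation′ n → Set ℓ)
  (resp : ∀ {π ρ} → π ≈ ρ → P π → P ρ)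
  (adjacent-step : ∀ {i j} v → toℕ j ≡ suc (toℕ i) → P (transpose i j ∘ₚ v) → P v)
  where

  private
    -- Induction on the gap `d` between `i` and `j`. With `s` the position after `i`,
    -- `transpose-conj` writes the swap as two adjacent swaps around one of smaller gap. Since
    -- `_∘ₚ_` applies its left argument first, `transpose i j ∘ₚ v` swaps positions of the listing
    -- `v`.
    increasing-step : ∀ d {i j} v → toℕ j ≡ suc (d + toℕ i) → P (transpose i j ∘ₚ v) → P v
    increasing-step zero    v e = adjacent-step v e
    increasing-step (suc d) {i} {j} v e Pij =
      adjacent-step v s≡i+1
        (increasing-step d (transpose i s ∘ₚ v) j≡s+d
          (adjacent-step (transpose s j ∘ₚ transpose i s ∘ₚ v) s≡i+1
            (resp (λ k → cong (v ⟨$⟩ʳ_) (transpose-conj i≢s s≢j i≢j k)) Pij)))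
      where
      i+1<n : suc (toℕ i) < n
      i+1<n = ≤-trans (s≤s (subst (suc (toℕ i) ≤_) (sym e) (s≤s (m≤n+m (toℕ i) (suc d))))) (toℕ<n j)

      s : Fin n
      s = fromℕ< i+1<n

      s≡i+1 : toℕ s ≡ suc (toℕ i)
      s≡i+1 = toℕ-fromℕ< i+1<n

      j≡s+d : toℕ j ≡ suc (d + toℕ s)
      j≡s+d = trans e (cong suc (sym (trans (cong (d +_) s≡i+1) (+-suc d (toℕ i)))))

      i≢s : i ≢ s
      i≢s i≡s = 1+n≢n (sym (trans (cong toℕ i≡s) s≡i+1))

      s≢j : s ≢ j
      s≢j s≡j = m≢1+n+m (toℕ s) (trans (cong toℕ s≡j) j≡s+d)

      i≢j : i ≢ j
      i≢j i≡j = m≢1+n+m (toℕ i) (trans (cong toℕ i≡j) e)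

    <-step : ∀ {i j} v → toℕ i < toℕ j → P (transpose i j ∘ₚ v) → P v
    <-step {i} v i<j with m≤n⇒∃[o]m+o≡n i<j
    ... | d , e = increasing-step d v (trans (sym e) (cong suc (+-comm (toℕ i) d)))

    transpose-step : ∀ i j v → P (transpose i j ∘ₚ v) → P v
    transpose-step i j v Pij with <-cmp (toℕ i) (toℕ j)
    ... | tri< i<j _ _ = <-step v i<j Pij
    ... | tri> _ _ j<i = <-step v j<i (resp (λ k → cong (v ⟨$⟩ʳ_) (transpose-comm i j k)) Pij)
    ... | tri≈ _ i≡j _ with refl ← toℕ-injective i≡j =
      resp (λ k → cong (v ⟨$⟩ʳ_) (transpose-refl i k)) Pij

    eval-step : (ts : TranspositionList n) → ∀ v → P (eval ts ∘ₚ v) → P v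
    eval-step []             v Pv = resp (λ _ → refl) Pv
    eval-step ((i , j) ∷ ts) v Pv =
      eval-step ts v (transpose-step i j (eval ts ∘ₚ v) (resp (λ _ → refl) Pv))

  adjacent-transpositions-generate : ∀ v w → P w → P v
  -- The permutation to decompose is `w` followed by the inverse of `v`; following it by `v` gives
  -- back `w`.
  adjacent-transpositions-generate v w Pw = eval-step (decompose (w ∘ₚ flip v)) v
    (resp (λ k → sym (trans (cong (v ⟨$⟩ʳ_) (eval-decompose (w ∘ₚ flip v) k)) (inverseʳ v))) Pw)

-- Switches on consecutive vertices

module _ (G : Graph n) {a b c d : Fin n} (p : Interchangeable ⟦ a , b ⨾ c , d ⟧ G)
  (bc : Adj G b c) (two : AtMostTwoNeighbours G)
  where
  private
    ab : Adj G a b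
    ab = proj₁ (proj₁ p)
    cd : Adj G c d
    cd = proj₂ (proj₁ p)
    a≢c : a ≢ c
    a≢c = proj₁ (proj₁ (proj₂ p))
    b≢c : b ≢ c
    b≢c = proj₁ (proj₂ (proj₂ (proj₁ (proj₂ p))))
    b≢d : b ≢ d
    b≢d = proj₂ (proj₂ (proj₂ (proj₁ (proj₂ p))))

    adj⇒≢ : ∀ {x y} → Adj G x y → x ≢ y
    adj⇒≢ xy x≡y = adj-irrefl G x≡y xy

    G′ : Graph n
    G′ = exchange ⟦ a , b ⨾ c , d ⟧ G p

    t : Fin n → Fin n
    t = transpose b c ⟨$⟩ʳ_

    ta≡a : t a ≡ a
    ta≡a = transpose-other (adj⇒≢ ab) a≢c

    td≡d : t d ≡ d
    td≡d = transpose-other (≢-sym b≢d) (≢-sym (adj⇒≢ cd))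

    tb≡c : t b ≡ c
    tb≡c = transpose-left b c

    tc≡b : t c ≡ b
    tc≡b = transpose-right b c

    t-swap : ∀ {x y} → t x ≡ y → x ≡ t y
    t-swap e = trans (sym (transpose-involutive b c _)) (cong t e)

    Adjᵗ : Fin n → Fin n → Set
    Adjᵗ x y = Adj G (t x) (t y)

    ¬samePair : ∀ {u v x y : Fin n} → x ≢ v → y ≢ v → ¬ SamePair u v x y
    ¬samePair x≢v y≢v (inj₁ (_ , y≡v)) = y≢v y≡v
    ¬samePair x≢v y≢v (inj₂ (x≡v , _)) = x≢v x≡v

    ¬samePair′ : ∀ {u v x y : Fin n} → x ≢ u → y ≢ u → ¬ SamePair u v x y
    ¬samePair′ x≢u y≢u (inj₁ (x≡u , _)) = x≢u x≡u
    ¬samePair′ x≢u y≢u (inj₂ (_ , y≡u)) = y≢u y≡u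

    bc′ : Adj G′ b c
    -- The edge bc survives because the removed edges contain a and d respectively, and neither is
    -- an end of bc.
    bc′ = inj₁ (bc , ¬samePair′ (≢-sym (adj⇒≢ ab)) (≢-sym a≢c) , ¬samePair b≢d (adj⇒≢ cd))

    -- In `G` the neighbours of b are a and c, and those of c are b and d. The switch gives b the
    -- neighbours c and d, which are the images under `t` of the old neighbours of c.
    -- `exchange-at-c` is the mirror image.
    exchange-at-b : ∀ y → Adj G′ b y ⇔ Adjᵗ b y
    exchange-at-b y = mk⇔ ⇒ ⇐
      where
      ⇒ : Adj G′ b y → Adjᵗ b y
      ⇒ (inj₁ (by , ¬ab , _)) with two by (adj-sym G ab) bc a≢c
      ... | inj₁ refl = contradiction (inj₂ (refl , refl)) ¬ab
      ... | inj₂ refl = subst₂ (Adj G) (sym tb≡c) (sym tc≡b) (adj-sym G bc)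
      ⇒ (inj₂ (inj₁ (inj₁ (b≡a , _)))) = contradiction (sym b≡a) (adj⇒≢ ab)
      ⇒ (inj₂ (inj₁ (inj₂ (b≡c , _)))) = contradiction b≡c b≢c
      ⇒ (inj₂ (inj₂ (inj₁ (_ , refl)))) = subst₂ (Adj G) (sym tb≡c) (sym td≡d) cd
      ⇒ (inj₂ (inj₂ (inj₂ (b≡d , _)))) = contradiction b≡d b≢d

      ⇐ : Adjᵗ b y → Adj G′ b y
      ⇐ e with two (subst (λ x → Adj G x (t y)) tb≡c e) (adj-sym G bc) cd b≢d
      ... | inj₁ ty≡b = subst (Adj G′ b) (sym (trans (t-swap ty≡b) tb≡c)) bc′
      ... | inj₂ ty≡d = inj₂ (inj₂ (inj₁ (refl , trans (t-swap ty≡d) td≡d)))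

    exchange-at-c : ∀ y → Adj G′ c y ⇔ Adjᵗ c y
    exchange-at-c y = mk⇔ ⇒ ⇐
      where
      ⇒ : Adj G′ c y → Adjᵗ c y
      ⇒ (inj₁ (cy , _ , ¬cd)) with two cy (adj-sym G bc) cd b≢d
      ... | inj₁ refl = subst₂ (Adj G) (sym tc≡b) (sym tb≡c) bc
      ... | inj₂ refl = contradiction (inj₁ (refl , refl)) ¬cd
      ⇒ (inj₂ (inj₁ (inj₁ (c≡a , _)))) = contradiction (sym c≡a) a≢c
      ⇒ (inj₂ (inj₁ (inj₂ (_ , refl)))) = subst₂ (Adj G) (sym tc≡b) (sym ta≡a) (adj-sym G ab)
      ⇒ (inj₂ (inj₂ (inj₁ (c≡b , _)))) = contradiction (sym c≡b) b≢c
      ⇒ (inj₂ (inj₂ (inj₂ (c≡d , _)))) = contradiction c≡d (adj⇒≢ cd)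

      ⇐ : Adjᵗ c y → Adj G′ c y
      ⇐ e with two (subst (λ x → Adj G x (t y)) tc≡b e) (adj-sym G ab) bc a≢c
      ... | inj₁ ty≡a = inj₂ (inj₁ (inj₂ (refl , trans (t-swap ty≡a) ta≡a)))
      ... | inj₂ ty≡c = subst (Adj G′ c) (sym (trans (t-swap ty≡c) tc≡b)) (adj-sym G′ bc′)

    -- Each of ab, cd, ac and bd has b or c as an end, so the switch changes nothing between other
    -- vertices, and `t` fixes those.
    exchange-away : ∀ {x y} → x ≢ b → x ≢ c → y ≢ b → y ≢ c → Adj G′ x y ⇔ Adjᵗ x y
    exchange-away {x} {y} x≢b x≢c y≢b y≢c = mk⇔ ⇒ ⇐
      where
      ⇒ : Adj G′ x y → Adjᵗ x y
      ⇒ (inj₁ (xy , _)) =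
        subst₂ (Adj G) (sym (transpose-other x≢b x≢c)) (sym (transpose-other y≢b y≢c)) xy
      ⇒ (inj₂ (inj₁ r)) = contradiction r (¬samePair x≢c y≢c)
      ⇒ (inj₂ (inj₂ r)) = contradiction r (¬samePair′ x≢b y≢b)

      ⇐ : Adjᵗ x y → Adj G′ x y
      ⇐ e = inj₁ ( subst₂ (Adj G) (transpose-other x≢b x≢c) (transpose-other y≢b y≢c) e
                 , ¬samePair x≢b y≢b , ¬samePair′ x≢c y≢c)

    symmetric : ∀ {x y} → Adj G′ x y ⇔ Adjᵗ x y → Adj G′ y x ⇔ Adjᵗ y x
    symmetric eq = mk⇔ (adj-sym G ∘ to eq ∘ adj-sym G′) (adj-sym G′ ∘ from eq ∘ adj-sym G)

  exchange-transposes : ∀ x y →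
    Adj (exchange ⟦ a , b ⨾ c , d ⟧ G p) x y ⇔
    Adj G (transpose b c ⟨$⟩ʳ x) (transpose b c ⟨$⟩ʳ y)
  exchange-transposes x y = cases (x ≟ b) (x ≟ c) (y ≟ b) (y ≟ c)
    where
    cases : ∀ {x y} → Dec (x ≡ b) → Dec (x ≡ c) → Dec (y ≡ b) → Dec (y ≡ c) →
      Adj G′ x y ⇔ Adjᵗ x y
    cases (yes refl) _          _          _          = exchange-at-b _
    cases (no _)     (yes refl) _          _          = exchange-at-c _
    cases (no _)     (no _)     (yes refl) _          = symmetric (exchange-at-b _)
    cases (no _)     (no _)     (no _)     (yes refl) = symmetric (exchange-at-c _)
    cases (no x≢b)   (no x≢c)   (no y≢b)   (no y≢c)   = exchange-away x≢b x≢c y≢b y≢c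

-- `τ` builds the exchange from the proof returned by `interchangeable?`, which need not be the
-- given `p`; hence the premise covers every proof.
τ-elim : ∀ {ℓ} (P : Graph n → Set ℓ) (A : Matrix n) {G : Graph n} → Interchangeable A G →
  (∀ p → P (exchange A G p)) → P (τ A G)
τ-elim P A {G} p P-exchange with interchangeable? A G
... | yes q = P-exchange q
... | no ¬p = contradiction p ¬p

cycleVia-adjacentSwitch : {v : Permutation′ n} {G : Graph n} → 4 ≤ n → CycleVia v G →
  ∀ {i j} → CyclicSuc i j →
  ∃ λ A → Interchangeable A G × CycleVia (transpose i j ∘ₚ v) (τ A G)
cycleVia-adjacentSwitch {n} {v} {G} 4≤n via {b} {c} b→c with predecessor b | successor c
... | a , a→b | d , c→d = A , p , τ-elim (CycleVia (transpose b c ∘ₚ v)) A p via-exchange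
  where
  3≤n : 3 ≤ n
  3≤n = ≤-trans (m≤m+n 3 1) 4≤n

  f : Fin n → Fin n
  f = v ⟨$⟩ʳ_

  A : Matrix n
  A = ⟦ f a , f b ⨾ f c , f d ⟧

  edge : ∀ {i j} → CyclicSuc i j → Adj G (f i) (f j)
  edge s = from (adjacency via _ _) (inj₁ s)

  a≢c : a ≢ c
  a≢c refl = ¬2-cyclic 3≤n a→b b→c
  -- On three vertices d would coincide with a; this is where a fourth vertex matters. It also keeps
  -- a, c and b, d from being consecutive.
  a≢d : a ≢ d
  a≢d refl = ¬3-cyclic 4≤n a→b b→c c→d
  b≢c : b ≢ c
  b≢c refl = a≢c (cycSuc-injective a→b b→c)
  b≢d : b ≢ d
  b≢d refl = ¬2-cyclic 3≤n b→c c→d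

  ¬consecutive-ac : ¬ Consecutive a c
  ¬consecutive-ac (inj₁ a→c) = b≢c (cycSuc-functional a→b a→c)
  ¬consecutive-ac (inj₂ c→a) = a≢d (cycSuc-functional c→a c→d)

  ¬consecutive-bd : ¬ Consecutive b d
  ¬consecutive-bd (inj₁ b→d) = b≢c (cycSuc-injective b→d c→d)
  ¬consecutive-bd (inj₂ d→b) = a≢d (cycSuc-injective a→b d→b)

  p : Interchangeable A G
  p = (edge a→b , edge c→d)
    , (a≢c ∘ to-injective v , a≢d ∘ to-injective v , b≢c ∘ to-injective v , b≢d ∘ to-injective v)
    , (¬consecutive-ac ∘ to (adjacency via a c) , ¬consecutive-bd ∘ to (adjacency via b d))

  -- The switch swaps the labels `f b` and `f c`, the new listing swaps the positions `b` and `c`;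
  -- by naturality the two swaps cancel.
  untranspose : ∀ k → transpose (f b) (f c) ⟨$⟩ʳ f (transpose b c ⟨$⟩ʳ k) ≡ f k
  untranspose k = trans (sym (transpose-natural v b c _)) (cong f (transpose-involutive b c k))

  via-exchange : ∀ q → CycleVia (transpose b c ∘ₚ v) (exchange A G q)
  via-exchange q = cycleVia λ i j → subst₂ (λ x y → Adj G x y ⇔ Consecutive i j)
      (sym (untranspose i)) (sym (untranspose j)) (adjacency via i j)
    ⇔-∘ exchange-transposes G q (edge b→c) (atMostTwoNeighbours via) _ _

-- Switch sequences between arbitrary cyclic orders

cycleVia-connectedBySwitches : 4 ≤ n → (v w : Permutation′ n) {H : Graph n} → CycleVia w H →
  ∀ G → CycleVia v G → ∃ λ As → USwitchSequence As G H
cycleVia-connectedBySwitches {n} 4≤n v w {H} viaH =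
  adjacent-transpositions-generate ReachesH resp step v w λ G viaG → [] , cycleVia-unique viaG viaH
  where
  3≤n : 3 ≤ n
  3≤n = ≤-trans (m≤m+n 3 1) 4≤n

  -- Quantifying over all graphs listed by `π` lets the property be applied to `τ A G` after a
  -- switch. One switch then realises one adjacent transposition, and at `w` the empty sequence
  -- suffices.
  ReachesH : Permutation′ n → Set₁
  ReachesH π = ∀ G → CycleVia π G → ∃ λ As → USwitchSequence As G H

  resp : ∀ {π ρ} → π ≈ ρ → ReachesH π → ReachesH ρ
  resp π≈ρ reaches G via = reaches G (cycleVia-resp-≈ (sym ∘ π≈ρ) via)

  step : ∀ {i j} π → toℕ j ≡ suc (toℕ i) → ReachesH (transpose i j ∘ₚ π) → ReachesH π
  step π e reaches G via with cycleVia-adjacentSwitch 4≤n via (inj₁ e)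
  ... | A , p , via′ with reaches (τ A G) via′
  ...   | As , sequence =
    A ∷ As , (cycleVia-unicyclic 3≤n via , p , cycleVia-unicyclic 3≤n via′) , sequence

-- The triangle

≢⇒consecutive : {i j : Fin 3} → i ≢ j → Consecutive i j
≢⇒consecutive {0F} {0F} i≢j = contradiction refl i≢j
≢⇒consecutive {0F} {1F} _   = inj₁ (inj₁ refl)
≢⇒consecutive {0F} {2F} _   = inj₂ (inj₂ (refl , refl))
≢⇒consecutive {1F} {0F} _   = inj₂ (inj₁ refl)
≢⇒consecutive {1F} {1F} i≢j = contradiction refl i≢j
≢⇒consecutive {1F} {2F} _   = inj₁ (inj₁ refl)
≢⇒consecutive {2F} {0F} _   = inj₁ (inj₂ (refl , refl))
≢⇒consecutive {2F} {1F} _   = inj₂ (inj₁ refl)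
≢⇒consecutive {2F} {2F} i≢j = contradiction refl i≢j

-- The right-hand side does not mention `v`, so any two triangles on these labels are equal and the
-- empty sequence joins them.
triangle-adj⇔≢ : {v : Permutation′ 3} {G : Graph 3} → CycleVia v G → ∀ x y → Adj G x y ⇔ x ≢ y
triangle-adj⇔≢ {v} {G} via x y = mk⇔ (λ xy x≡y → adj-irrefl G x≡y xy)
  λ x≢y → from (adj⇔consecutive via x y) (≢⇒consecutive (x≢y ∘ to-injective (flip v)))

theorem3p8 : (n : ℕ) (C C′ : Graph n) → IsCycleGraph C → IsCycleGraph C′ →
    degreeSequence C ≡ degreeSequence C′ →
    ∃ λ As → USwitchSequence As C C′
theorem3p8 n C C′ (3≤n , v , via) (_ , w , via′) _ with 3 <? n
... | yes 4≤n = cycleVia-connectedBySwitches 4≤n v w (cycleVia via′) C (cycleVia via)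
... | no  3≮n with refl ← ≤-antisym 3≤n (≮⇒≥ 3≮n) =
  [] , λ x y → ⇔-sym (triangle-adj⇔≢ {w} {C′} (cycleVia via′) x y) ⇔-∘
    triangle-adj⇔≢ {v} {C} (cycleVia via) x y
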